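{- (i) Let $A=\mathrm{GF}(2)$ and $n\ge2$. The set of all permutations of $A^n$ which can be computed (without memory) by programs consisting only of binary instructions is the affine group $\mathrm{Aff}(n,2)$. (ii) Let $A$ be any finite alphabet with $|A|\ge2$ and let $n\ge 2$. When using one memory cell, every transformation $f$ of $A^n$ can be computed by binary instructions.
   Context: For $N\ge1$, a transformation of $A^N$ is a map $h=(h_1,\dots,h_N):A^N\to A^N$; its coordinate function $h_i:A^N\to A$ is trivial if $h_i(x)=x_i$ for all $x$. An instruction of $A^N$ is a transformation $g$ of $A^N$ with at most one nontrivial coordinate function $g_i$, written $y_i\gets g_i(y)$. The instruction is binary if $g_i$ depends on at most two variables, i.e. $g_i(y)=g_i(y_j,y_k)$ for some $j,k\in\{1,\dots,N\}$. A program computing $h$ is a finite sequence of instructions $g^1,\dots,g^L$ of $A^N$ with $h=g^L\circ\cdots\circ g^1$; computing $f:A^n\to A^n$ without memory means $N=n$ and $h=f$. Computing a transformation $f$ of $A^n$ with one memory cell means computing, by a program with instructions of $A^{n+1}$, some transformation $h$ of $A^{n+1}$ with $h_i(x_1,\dots,x_{n+1})=f_i(x_1,\dots,x_n)$ for all $1\le i\le n$ and all $(x_1,\dots,x_{n+1})\in A^{n+1}$. $\mathrm{Aff}(n,2)$ is the group of maps $x\mapsto xM+c$ on $\mathrm{GF}(2)^n$ with $M$ an invertible $n\times n$ matrix over $\mathrm{GF}(2)$ and $c\in\mathrm{GF}(2)^n$. -}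

module Defs where

open import Algebra.Bundles using (CommutativeRing)
import Algebra.Properties.Monoid.Sum as MonoidSum
open import Data.Bool.Base using (Bool; if_then_else_)
open import Data.Bool.Properties using (xor-∧-commutativeRing)
open import Data.Fin.Base using (Fin; inject₁)
open import Data.Fin.Properties using (_≟_)
open import Data.List.Base using (List; []; _∷_)
open import Data.List.Relation.Unary.All using (All)
open import Data.Nat.Base using (ℕ; suc)
open import Data.Product.Base using (∃; ∃₂; _×_)
open import Data.Vec.Base using (Vec; lookup; tabulate; _∷ʳ_)
open import Function.Definitions using (Bijective)
open import Level using (Level; 0ℓ)
open import Relation.Binary.PropositionalEquality.Core using (_≡_; _≢_; _≗_)
open import Relation.Nullary.Decidable.Core using (⌊_⌋)
open import Relation.Unary using (Pred)

private
  variable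
    a : Level
    A : Set a
    n N : ℕ

------------------------------------------------------------------------
-- Transformations, instructions and programs

Transformation : Set a → ℕ → Set a
Transformation A N = Vec A N → Vec A N

coord : Transformation A N → Fin N → Vec A N → A
coord h i x = lookup (h x) i

Trivial : Transformation A N → Fin N → Set _
Trivial h i = ∀ x → coord h i x ≡ lookup x i

-- For N ≥ 1, "at most one nontrivial coordinate function" means that all
-- coordinate functions other than some chosen one are trivial; the chosen
-- one may be trivial too, so the identity is an instruction.
record Instruction (A : Set a) (N : ℕ) : Set a where
  field
    map     : Transformation A N
    target  : Fin N
    trivial : ∀ i → i ≢ target → Trivial map i

-- j and k may coincide, and either may be the target.
Binary : Instruction A N → Set _
Binary {A = A} g =
  ∃₂ λ j k → ∃ λ (φ : A → A → A) →
    ∀ y → coord map target y ≡ φ (lookup y j) (lookup y k)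
  where open Instruction g

Program : Set a → ℕ → Set a
Program A N = List (Instruction A N)

-- The head of the list is executed first.
run : Program A N → Transformation A N
run []      x = x
run (g ∷ p) x = run p (Instruction.map g x)

BinaryComputable : Transformation A N → Set _
BinaryComputable h = ∃ λ p → All Binary p × run p ≗ h

-- The memory cell is the last coordinate; its initial content m is
-- arbitrary and its final content is unconstrained.
BinaryComputableWithOneCell : Transformation A n → Set _
BinaryComputableWithOneCell {A = A} {n = n} f =
  ∃ λ (h : Transformation A (suc n)) →
    BinaryComputable h ×
    (∀ (x : Vec A n) (m : A) (i : Fin n) →
       coord h (inject₁ i) (x ∷ʳ m) ≡ coord f i x)

Permutation : Pred (Transformation A n) _
Permutation = Bijective _≡_ _≡_

------------------------------------------------------------------------
-- The affine group over GF(2)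

GF2 : Set
GF2 = Bool

open CommutativeRing xor-∧-commutativeRing
  using (_+_; _*_; 0#; 1#; +-monoid)
open MonoidSum +-monoid using (sum)

Matrix : ℕ → Set
Matrix n = Fin n → Fin n → GF2

identity : Matrix n
identity i j = if ⌊ i ≟ j ⌋ then 1# else 0#

infixl 7 _⊗_ _·_

_⊗_ : Matrix n → Matrix n → Matrix n
(M ⊗ M′) i j = sum λ k → M i k * M′ k j

Invertible : Matrix n → Set
Invertible {n} M = ∃ λ (M′ : Matrix n) →
  (∀ i j → (M ⊗ M′) i j ≡ identity i j) ×
  (∀ i j → (M′ ⊗ M) i j ≡ identity i j)

-- Vectors are row vectors.
_·_ : Vec GF2 n → Matrix n → Vec GF2 n
x · M = tabulate λ j → sum λ i → lookup x i * M i j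

infixl 6 _⊕_

_⊕_ : Vec GF2 n → Vec GF2 n → Vec GF2 n
x ⊕ c = tabulate λ j → lookup x j + lookup c j

Aff : ∀ n → Pred (Transformation GF2 n) 0ℓ
Aff n f = ∃₂ λ (M : Matrix n) (c : Vec GF2 n) →
  Invertible M × (∀ x → f x ≡ x · M ⊕ c)

{-# OPTIONS --safe #-}

-- (i) If a program computes a permutation, each of its instructions is
-- injective. An injective binary instruction on GF(2) updates a cell t to
-- y_t + ψ(y_k), or to an injective function of y_t alone, and every function
-- of one bit is affine; so the program is affine. Conversely, Gaussian
-- elimination on the inverse g of an affine permutation f, by translations and
-- shears y ↦ y + y_s c with c_s = 0, gives a binary h with h ∘ g = id, so h = f.
--
-- (ii) The memory cell can evaluate a conjunction of one-coordinate tests by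
-- binary instructions, hence a coordinate can be modified on exactly one line
-- of Aⁿ. This gives the swaps and the assignments between states at Hamming
-- distance 1; conjugating along paths gives them between any two states, and
-- they generate all transformations.
module Submission where

open import Defs
open import Algebra.Bundles using (CommutativeRing)
import Algebra.Properties.CommutativeMonoid.Sum as CommutativeMonoidSum
import Algebra.Properties.Semiring.Sum as SemiringSum
open import Data.Bool.Base using (Bool; true; false; T; not; _∧_; _xor_; if_then_else_)
open import Data.Bool.ListAction using (all)
open import Data.Bool.Properties
  using (∧-assoc; xor-∧-commutativeRing; ¬-not; not-¬; not-involutive; xor-identityʳ)
  renaming (_≟_ to _≟ᵇ_)
open import Data.Bool.Solver using (module xor-∧-Solver)
open import Data.Fin.Base using (Fin; zero; suc; inject₁; fromℕ; toℕ; fromℕ<)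
open import Data.Fin.Properties using (toℕ-fromℕ<; toℕ<n; toℕ-injective; ¬∀⟶∃¬)
  renaming (_≟_ to _≟ᶠ_)
open import Data.List.Base using (List; []; _∷_; _++_; allFin; cartesianProductWith)
  renaming (map to mapᴸ)
open import Data.List.Membership.Propositional using (_∈_; _∉_)
open import Data.List.Membership.Propositional.Properties
  using (∈-allFin; ∈-map⁺; ∈-map⁻; ∈-cartesianProductWith⁺)
import Data.List.Membership.DecPropositional as DecMembership
open import Data.List.Relation.Unary.All as All using (All; []; _∷_)
open import Data.List.Relation.Unary.All.Properties using (++⁺; all⁺; all⁻)
open import Data.List.Relation.Unary.Any using (here; there)
open import Data.Nat.Base using (ℕ; zero; suc; _≤_; z≤n; s≤s)
open import Data.Nat.Properties using (_≤?_; ≤-refl; ≤-reflexive; <⇒≤; ≤∧≢⇒<; <⇒≱)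
open import Data.Product.Base using (∃; _×_; _,_; proj₁; proj₂)
open import Data.Sum.Base using (_⊎_; inj₁; inj₂)
open import Data.Vec.Base using (Vec; []; _∷_; lookup; tabulate; replicate; _[_]≔_; _∷ʳ_)
open import Data.Vec.Properties
  using (lookup∘update; lookup∘update′; lookup∘tabulate; lookup-replicate;
         []≔-lookup; []≔-idempotent; []≔-commutes; ≡-dec)
open import Data.Vec.Relation.Binary.Pointwise.Extensional using (ext; Pointwise-≡⇒≡)
open import Function.Base using (_∘_; id)
open import Function.Bundles using (_↔_; Inverse)
open import Function.Definitions using (Injective)
open import Function.Properties.Inverse using (↔⇒↣)
open import Relation.Binary.Definitions using (DecidableEquality)
open import Relation.Binary.PropositionalEquality
open import Relation.Nullary.Decidable
  using (yes; no; does; ⌊_⌋; toWitness; fromWitness; via-injection; _⊎-dec_; _→-dec_;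
         dec-true; dec-false; isYes≗does; decidable-stable)
open import Relation.Nullary.Negation using (contradiction; ¬_)
open import Relation.Unary using (_∩_; _≐_)

-- Vectors: extensionality and paths changing one coordinate at a time

vec-ext : ∀ {A : Set} {n} {x y : Vec A n} → (∀ i → lookup x i ≡ lookup y i) → x ≡ y
vec-ext p = Pointwise-≡⇒≡ (ext p)

-- Overwriting the entries of the first vector by those of the second, one at a time, is a path of
-- `edge` steps. With an implication as `R`, this becomes an induction over coordinates.
≔-connected : ∀ {A : Set} {n} (R : Vec A n → Vec A n → Set) →
  (∀ {a} → R a a) → (∀ {a b c} → R a b → R b c → R a c) →
  (∀ a i b → R a (a [ i ]≔ b)) → ∀ a b → R a b
≔-connected R rfl trs edge []      []      = rfl
≔-connected R rfl trs edge (x ∷ a) (y ∷ b) = trs (edge (x ∷ a) zero y)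
  (≔-connected (λ u v → R (y ∷ u) (y ∷ v)) rfl trs (λ u i → edge (y ∷ u) (suc i)) a b)

-- Binary programs, with and without the memory cell

module _ {A : Set} where

  private variable
    n N : ℕ
    f g : Transformation A N

  write : (i j k : Fin N) → (A → A → A) → Instruction A N
  write i j k φ = record
    { map     = λ y → y [ i ]≔ φ (lookup y j) (lookup y k)
    ; target  = i
    ; trivial = λ l l≢i y → lookup∘update′ l≢i y _
    }

  run-++ : ∀ (p q : Program A N) x → run (p ++ q) x ≡ run q (run p x)
  run-++ []      q x = refl
  run-++ (g ∷ p) q x = run-++ p q (Instruction.map g x)

  binary-id : BinaryComputable (id {A = Vec A N})
  binary-id = [] , [] , λ _ → refl

  binary-∘ : BinaryComputable g → BinaryComputable f → BinaryComputable (g ∘ f)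
  binary-∘ {g = g} (q , bq , rq) (p , bp , rp) = p ++ q , ++⁺ bp bq , λ x →
    trans (run-++ p q x) (trans (rq _) (cong g (rp x)))

  binary-resp-≗ : f ≗ g → BinaryComputable f → BinaryComputable g
  binary-resp-≗ f≗g (p , bp , rp) = p , bp , λ x → trans (rp x) (f≗g x)

  binary-write : ∀ (i j k : Fin N) φ → BinaryComputable (Instruction.map (write i j k φ))
  binary-write i j k φ =
    write i j k φ ∷ [] , (j , k , φ , λ y → lookup∘update i y _) ∷ [] , λ _ → refl

  lookup-∷ʳ-inject₁ : ∀ (x : Vec A n) m i → lookup (x ∷ʳ m) (inject₁ i) ≡ lookup x i
  lookup-∷ʳ-inject₁ (_ ∷ x) m zero    = refl
  lookup-∷ʳ-inject₁ (_ ∷ x) m (suc i) = lookup-∷ʳ-inject₁ x m i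

  lookup-∷ʳ-fromℕ : ∀ (x : Vec A n) m → lookup (x ∷ʳ m) (fromℕ n) ≡ m
  lookup-∷ʳ-fromℕ []      m = refl
  lookup-∷ʳ-fromℕ (_ ∷ x) m = lookup-∷ʳ-fromℕ x m

  ≔-∷ʳ-inject₁ : ∀ (x : Vec A n) m i a → (x ∷ʳ m) [ inject₁ i ]≔ a ≡ (x [ i ]≔ a) ∷ʳ m
  ≔-∷ʳ-inject₁ (_ ∷ x) m zero    a = refl
  ≔-∷ʳ-inject₁ (y ∷ x) m (suc i) a = cong (y ∷_) (≔-∷ʳ-inject₁ x m i a)

  ≔-∷ʳ-fromℕ : ∀ (x : Vec A n) m a → (x ∷ʳ m) [ fromℕ n ]≔ a ≡ x ∷ʳ a
  ≔-∷ʳ-fromℕ []      m a = refl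
  ≔-∷ʳ-fromℕ (y ∷ x) m a = cong (y ∷_) (≔-∷ʳ-fromℕ x m a)

  -- Unlike BinaryComputableWithOneCell, this relates whole states, hence
  -- is evidently closed under composition.
  OneCell : Transformation A n → Set
  OneCell {n} f = ∃ λ (h : Transformation A (suc n)) →
    BinaryComputable h × (∀ x m → ∃ λ m′ → h (x ∷ʳ m) ≡ f x ∷ʳ m′)

  oneCell-id : OneCell (id {A = Vec A n})
  oneCell-id = id , binary-id , λ x m → m , refl

  oneCell-∘ : OneCell g → OneCell f → OneCell (g ∘ f)
  oneCell-∘ {f = f} (k , bk , rk) (h , bh , rh) = k ∘ h , binary-∘ bk bh , λ x m →
    let m′ , eq = rh x m; m″ , eq′ = rk (f x) m′ in m″ , trans (cong k eq) eq′

  oneCell-resp-≗ : f ≗ g → OneCell f → OneCell g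
  oneCell-resp-≗ f≗g (h , bh , rh) = h , bh , λ x m →
    let m′ , eq = rh x m in m′ , trans eq (cong (_∷ʳ m′) (f≗g x))

  oneCell⇒binaryWithOneCell : OneCell f → BinaryComputableWithOneCell f
  oneCell⇒binaryWithOneCell {f = f} (h , bh , rh) = h , bh , λ x m i →
    let m′ , eq = rh x m in
    trans (cong (λ y → lookup y (inject₁ i)) eq) (lookup-∷ʳ-inject₁ (f x) m′ i)

-- Swaps and assignments, and the maps they generate

module Swap {X : Set} (_≟_ : DecidableEquality X) where

  swap : X → X → X → X
  swap a b x = if does (x ≟ a) then b else if does (x ≟ b) then a else x

  assign : X → X → X → X
  assign a b x = if does (x ≟ a) then b else x

  swap-left : ∀ a b → swap a b a ≡ b
  swap-left a b rewrite dec-true (a ≟ a) refl = refl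

  swap-right : ∀ a b → swap a b b ≡ a
  swap-right a b with b ≟ a
  ... | yes b≡a = b≡a
  ... | no _ rewrite dec-true (b ≟ b) refl = refl

  swap-other : ∀ {a b x} → x ≢ a → x ≢ b → swap a b x ≡ x
  swap-other {a} {b} {x} x≢a x≢b
    rewrite dec-false (x ≟ a) x≢a | dec-false (x ≟ b) x≢b = refl

  assign-here : ∀ a b → assign a b a ≡ b
  assign-here a b rewrite dec-true (a ≟ a) refl = refl

  assign-other : ∀ {a b x} → x ≢ a → assign a b x ≡ x
  assign-other {a} {b} {x} x≢a rewrite dec-false (x ≟ a) x≢a = refl

  swap-same : ∀ a x → swap a a x ≡ x
  swap-same a x with x ≟ a
  ... | yes x≡a = sym x≡a
  ... | no _    = refl

  assign-same : ∀ a x → assign a a x ≡ x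
  assign-same a x with x ≟ a
  ... | yes x≡a = sym x≡a
  ... | no _    = refl

  swap-involutive : ∀ a b x → swap a b (swap a b x) ≡ x
  swap-involutive a b x with x ≟ a
  ... | yes refl = swap-right x b
  ... | no x≢a with x ≟ b
  ...   | yes refl = swap-left a x
  ...   | no x≢b   = swap-other x≢a x≢b

  by-cases : ∀ (P : X → Set) {a b c} → P a → P b → P c →
             (∀ {x} → x ≢ a → x ≢ b → x ≢ c → P x) → ∀ x → P x
  by-cases P {a} {b} {c} pa pb pc other x with x ≟ a | x ≟ b | x ≟ c
  ... | yes refl | _        | _        = pa
  ... | no _     | yes refl | _        = pb
  ... | no _     | no _     | yes refl = pc
  ... | no x≢a   | no x≢b   | no x≢c   = other x≢a x≢b x≢c

  chain : ∀ (h g f : X → X) {x y z w} → f x ≡ y → g y ≡ z → h z ≡ w → h (g (f x)) ≡ w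
  chain h g f refl refl refl = refl

  -- Conjugation by a permutation renames the points of a transposition: `swap a c` renames `c` to
  -- `a` in `swap c b`, and leaves `b` alone.
  swap-conj : ∀ {a b c} → a ≢ b → a ≢ c → b ≢ c →
              swap a c ∘ swap c b ∘ swap a c ≗ swap a b
  swap-conj {a} {b} {c} a≢b a≢c b≢c = by-cases _
    (trans (compute (swap-left a c) (swap-left c b) (swap-other (a≢b ∘ sym) b≢c))
           (sym (swap-left a b)))
    (trans (compute (swap-other (a≢b ∘ sym) b≢c) (swap-right c b) (swap-right a c))
           (sym (swap-right a b)))
    (trans (compute (swap-right a c) (swap-other a≢c a≢b) (swap-left a c))
           (sym (swap-other (a≢c ∘ sym) (b≢c ∘ sym))))
    (λ x≢a x≢b x≢c →
      trans (compute (swap-other x≢a x≢c) (swap-other x≢c x≢b) (swap-other x≢a x≢c))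
            (sym (swap-other x≢a x≢b)))
    where compute = chain (swap a c) (swap c b) (swap a c)

  -- Here `swap c b` renames the destination `c` to `b` and leaves the source `a` alone.
  assign-conj : ∀ {a b c} → a ≢ b → a ≢ c → b ≢ c →
                swap c b ∘ assign a c ∘ swap c b ≗ assign a b
  assign-conj {a} {b} {c} a≢b a≢c b≢c = by-cases _
    (trans (compute (swap-other a≢c a≢b) (assign-here a c) (swap-left c b))
           (sym (assign-here a b)))
    (trans (compute (swap-right c b) (assign-other (a≢c ∘ sym)) (swap-left c b))
           (sym (assign-other (a≢b ∘ sym))))
    (trans (compute (swap-left c b) (assign-other (a≢b ∘ sym)) (swap-right c b))
           (sym (assign-other (a≢c ∘ sym))))
    (λ x≢a x≢b x≢c →
      trans (compute (swap-other x≢c x≢b) (assign-other x≢a) (swap-other x≢c x≢b))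
            (sym (assign-other x≢a)))
    where compute = chain (swap c b) (assign a c) (swap c b)

module SwapMap {X Y : Set} (_≟ˣ_ : DecidableEquality X) (_≟ʸ_ : DecidableEquality Y) where
  private
    module X = Swap _≟ˣ_
    module Y = Swap _≟ʸ_

  -- Meant for `e c = a [ i ]≔ c`: on a line of states, a swap of two states is a swap of two
  -- letters.
  swap-map : ∀ {e : X → Y} → (∀ {u v} → e u ≡ e v → u ≡ v) → ∀ a b x →
             Y.swap (e a) (e b) (e x) ≡ e (X.swap a b x)
  swap-map {e} inj a b x with x ≟ˣ a
  ... | yes refl = Y.swap-left (e x) (e b)
  ... | no x≢a with x ≟ˣ b
  ...   | yes refl = Y.swap-right (e a) (e x)
  ...   | no x≢b   = Y.swap-other (x≢a ∘ inj) (x≢b ∘ inj)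

  assign-map : ∀ {e : X → Y} → (∀ {u v} → e u ≡ e v → u ≡ v) → ∀ a b x →
               Y.assign (e a) (e b) (e x) ≡ e (X.assign a b x)
  assign-map {e} inj a b x with x ≟ˣ a
  ... | yes refl = Y.assign-here (e x) (e b)
  ... | no x≢a   = Y.assign-other (x≢a ∘ inj)

-- Enumerate X as x₁, x₂, … and build f on longer and longer sets of xₖ.
-- The elements not treated yet must stay isolated, i.e. share their image
-- with no other element: then moving h x to f x can be done by a swap if
-- f x is not yet a value of f, and otherwise by an assignment, which keeps
-- the remaining elements isolated.
module Generation {X : Set} (_≟_ : DecidableEquality X)
  (Gen : (X → X) → Set)
  (gen-id : Gen id)
  (gen-∘ : ∀ {g f} → Gen g → Gen f → Gen (g ∘ f))
  (gen-swap : ∀ a b → Gen (Swap.swap _≟_ a b))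
  (gen-assign : ∀ a b → Gen (Swap.assign _≟_ a b))
  where

  open Swap _≟_
  open DecMembership _≟_ using (_∈?_)

  Isolated : (X → X) → X → Set
  Isolated h y = ∀ z → h z ≡ h y → z ≡ y

  generate-on : ∀ (f : X → X) L → ∃ λ h → Gen h ×
    (∀ {x} → x ∈ L → h x ≡ f x) × (∀ {y} → y ∉ L → Isolated h y)
  generate-on f []      = id , gen-id , (λ ()) , λ _ z z≡y → z≡y
  generate-on f (x ∷ L) with generate-on f L | x ∈? L
  ... | h , gh , agree , isolated | yes x∈L = h , gh ,
    (λ { (here refl) → agree x∈L ; (there w∈L) → agree w∈L }) ,
    λ y∉ → isolated (y∉ ∘ there)
  ... | h , gh , agree , isolated | no x∉L with f x ∈? mapᴸ f L
  ...   | no fx∉ = swap (h x) (f x) ∘ h , gen-∘ (gen-swap (h x) (f x)) gh ,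
    (λ { (here refl) → swap-left (h x) (f x)
       ; (there w∈L) → trans
           (swap-other (λ eq → x∉L (subst (_∈ L) (isolated x∉L _ eq) w∈L))
                       (λ eq → fx∉ (subst (_∈ mapᴸ f L) (trans (sym (agree w∈L)) eq) (∈-map⁺ f w∈L))))
           (agree w∈L) }) ,
    -- A swap is injective, being an involution, so it cancels and isolation carries over.
    λ y∉ z eq → isolated (y∉ ∘ there) z
      (trans (sym (swap-involutive (h x) (f x) (h z)))
        (trans (cong (swap (h x) (f x)) eq) (swap-involutive (h x) (f x) _)))
  ...   | yes fx∈ with ∈-map⁻ f fx∈
  ...     | x′ , x′∈L , fx≡fx′ = assign (h x) (f x) ∘ h , gen-∘ (gen-assign (h x) (f x)) gh ,
    (λ { (here refl) → assign-here (h x) (f x)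
       ; (there w∈L) → trans (assign-other (λ eq → x∉L (subst (_∈ L) (isolated x∉L _ eq) w∈L)))
                             (agree w∈L) }) ,
    λ {y} y∉ z eq →
      let iso-y = isolated (y∉ ∘ there)
          hy-fixed = assign-other {b = f x} (λ hy≡hx → y∉ (here (isolated x∉L y hy≡hx)))
          eq′ = trans eq hy-fixed
      in case-z y∉ z iso-y eq′ (z ≟ x)
    where
    case-z : ∀ {y} → y ∉ x ∷ L → ∀ z → Isolated h y → assign (h x) (f x) (h z) ≡ h y → _ → z ≡ y
    -- If `z` is `x`, then `h y = f x = f x′ = h x′`, so isolation of `y` forces `x′ = y`, although
    -- `x′` lies in `L` and `y` does not.
    case-z {y} y∉ z iso-y eq (yes refl) = contradiction
      (subst (_∈ L) (iso-y x′ (trans (agree x′∈L)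
        (trans (sym fx≡fx′) (trans (sym (assign-here (h x) (f x))) eq)))) x′∈L)
      (y∉ ∘ there)
    case-z y∉ z iso-y eq (no z≢x) =
      iso-y z (trans (sym (assign-other (λ hz≡hx → z≢x (isolated x∉L z hz≡hx)))) eq)

  generate : ∀ (f : X → X) L → (∀ x → x ∈ L) → ∃ λ h → Gen h × h ≗ f
  generate f L complete =
    let h , gh , agree , _ = generate-on f L in h , gh , λ x → agree (complete x)

-- Guarded updates using the memory cell

-- The memory cell accumulates a conjunction of tests on single coordinates,
-- one coordinate at a time.
module Guard {A : Set} (_≟_ : DecidableEquality A) {on off : A} (on≢off : on ≢ off) where

  private variable n : ℕ

  encode : Bool → A
  encode b = if b then on else off

  decode : A → Bool
  decode a = does (a ≟ on)

  decode-encode : ∀ b → decode (encode b) ≡ b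
  decode-encode true  = dec-true (on ≟ on) refl
  decode-encode false = dec-false (off ≟ on) (on≢off ∘ sym)

  passes : (Fin n → A → Bool) → List (Fin n) → Vec A n → Bool
  passes P js x = all (λ j → P j (lookup x j)) js

  accumulate : ∀ (P : Fin n → A → Bool) js → ∃ λ h → BinaryComputable h ×
    (∀ x b → h (x ∷ʳ encode b) ≡ x ∷ʳ encode (b ∧ passes P js x))
  accumulate P [] = id , binary-id , λ { x true → refl ; x false → refl }
  accumulate {n} P (j ∷ js) =
    let h , bh , rh = accumulate P js in
    h ∘ Instruction.map (write (fromℕ n) (fromℕ n) (inject₁ j) φ) ,
    binary-∘ bh (binary-write (fromℕ n) (fromℕ n) (inject₁ j) φ) , λ x b →
      trans (cong h (trans (≔-∷ʳ-fromℕ x (encode b) _)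
              (cong₂ (λ m a → x ∷ʳ encode (m ∧ P j a))
                (trans (cong decode (lookup-∷ʳ-fromℕ x (encode b))) (decode-encode b))
                (lookup-∷ʳ-inject₁ x (encode b) j))))
        (trans (rh x _) (cong (λ c → x ∷ʳ encode c) (∧-assoc b _ _)))
    where
    -- Each test reads only the memory cell and coordinate `j`, so every write stays binary however
    -- many tests are conjoined.
    φ : A → A → A
    φ m a = encode (decode m ∧ P j a)

  guarded : (Fin n → A → Bool) → Fin n → (A → A) → Transformation A n
  guarded P i π x =
    x [ i ]≔ (if passes P (allFin _) x then π (lookup x i) else lookup x i)

  -- Three phases: `init` sets the memory to `on`, whatever it held; `accumulate` stores the verdict
  -- there; `act` updates coordinate `i` reading only itself and the memory. All tests precede the
  -- update, so they see the original state.
  oneCell-guarded : ∀ (P : Fin n → A → Bool) i π → OneCell (guarded P i π)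
  oneCell-guarded {n} P i π =
    let h , bh , rh = accumulate P (allFin n) in
    act ∘ h ∘ init ,
    binary-∘ (binary-write (inject₁ i) (inject₁ i) (fromℕ n) φ)
      (binary-∘ bh (binary-write (fromℕ n) (fromℕ n) (fromℕ n) (λ _ _ → on))) , λ x m →
      let b = passes P (allFin n) x in encode b ,
      trans (cong act (trans (cong h (≔-∷ʳ-fromℕ x m on)) (rh x true)))
        (trans (≔-∷ʳ-inject₁ x (encode b) i _)
          (cong (λ a → (x [ i ]≔ a) ∷ʳ encode b)
            (cong₂ (λ c a → if c then π a else a)
              (trans (cong decode (lookup-∷ʳ-fromℕ x (encode b))) (decode-encode b))
              (lookup-∷ʳ-inject₁ x (encode b) i))))
    where
    φ : A → A → A
    φ a m = if decode m then π a else a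

    init act : Transformation A (suc n)
    init = Instruction.map (write (fromℕ n) (fromℕ n) (fromℕ n) (λ _ _ → on))
    act  = Instruction.map (write (inject₁ i) (inject₁ i) (fromℕ n) φ)

  oneCell-on-line : ∀ (a : Vec A n) i (F : Transformation A n) π →
    (∀ c → F (a [ i ]≔ c) ≡ a [ i ]≔ π c) →
    (∀ x → (∀ c → x ≢ a [ i ]≔ c) → F x ≡ x) → OneCell F
  oneCell-on-line {n} a i F π on-line off-line =
    oneCell-resp-≗ guarded≗F (oneCell-guarded P i π)
    where
    P : Fin n → A → Bool
    -- Coordinate `i` passes with any letter and every other coordinate must agree with `a`, so the
    -- conjunction holds exactly on the line through `a` in direction `i`.
    P j c = ⌊ (j ≟ᶠ i) ⊎-dec (c ≟ lookup a j) ⌋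

    passes⇒on-line : ∀ x → T (passes P (allFin n) x) → x ≡ a [ i ]≔ lookup x i
    passes⇒on-line x t = vec-ext agree
      where
      agree : ∀ j → lookup x j ≡ lookup (a [ i ]≔ lookup x i) j
      agree j with j ≟ᶠ i | toWitness {a? = (j ≟ᶠ i) ⊎-dec (lookup x j ≟ lookup a j)}
                              (All.lookup (all⁺ _ _ t) (∈-allFin j))
      ... | yes refl | _         = sym (lookup∘update j a _)
      ... | no j≢i | inj₁ j≡i = contradiction j≡i j≢i
      ... | no j≢i | inj₂ eq  = trans eq (sym (lookup∘update′ j≢i a _))

    on-line⇒passes : ∀ c → T (passes P (allFin n) (a [ i ]≔ c))
    on-line⇒passes c = all⁻ (λ j → P j (lookup (a [ i ]≔ c) j))
      (All.universal (λ j → fromWitness (agree j)) (allFin n))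
      where
      agree : ∀ j → j ≡ i ⊎ lookup (a [ i ]≔ c) j ≡ lookup a j
      agree j with j ≟ᶠ i
      ... | yes j≡i = inj₁ j≡i
      ... | no j≢i  = inj₂ (lookup∘update′ j≢i a c)

    guarded≗F : guarded P i π ≗ F
    guarded≗F x with passes P (allFin n) x in eq
    ... | true  =
      let x≡ = passes⇒on-line x (subst T (sym eq) _) in
      sym (trans (cong F x≡) (trans (on-line _)
        (trans (sym ([]≔-idempotent a i)) (cong (_[ i ]≔ π (lookup x i)) (sym x≡)))))
    ... | false = trans ([]≔-lookup x i) (sym (off-line x λ c x≡ →
      subst T (trans (cong (passes P (allFin n)) (sym x≡)) eq) (on-line⇒passes c)))

-- Moves between arbitrary states, and all transformations with one cell

module _ {A : Set} (_≟_ : DecidableEquality A) {on off : A} (on≢off : on ≢ off) where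

  open Guard _≟_ on≢off

  private
    variable n : ℕ

    _≟ⱽ_ : DecidableEquality (Vec A n)
    _≟ⱽ_ = ≡-dec _≟_

    module A = Swap _≟_
    module V {n} = Swap (_≟ⱽ_ {n})
    module M {n} = SwapMap _≟_ (_≟ⱽ_ {n})

    Moves : Vec A n → Vec A n → Set
    Moves a b = OneCell (V.swap a b) × OneCell (V.assign a b)

    moves-refl : ∀ {a : Vec A n} → Moves a a
    moves-refl {a = a} = oneCell-resp-≗ (sym ∘ V.swap-same a) oneCell-id ,
                         oneCell-resp-≗ (sym ∘ V.assign-same a) oneCell-id

    -- Conjugation handles three distinct states; if two of them coincide, the move is trivial or
    -- one of the given ones.
    moves-trans : ∀ {a c b : Vec A n} → Moves a c → Moves c b → Moves a b
    moves-trans {a = a} {c} {b} ac@(sac , dac) cb@(scb , dcb) with a ≟ⱽ b | a ≟ⱽ c | b ≟ⱽ c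
    ... | yes refl | _        | _        = moves-refl
    ... | no _     | yes refl | _        = cb
    ... | no _     | no _     | yes refl = ac
    ... | no a≢b   | no a≢c   | no b≢c   =
      oneCell-resp-≗ (V.swap-conj a≢b a≢c b≢c) (oneCell-∘ sac (oneCell-∘ scb sac)) ,
      oneCell-resp-≗ (V.assign-conj a≢b a≢c b≢c) (oneCell-∘ scb (oneCell-∘ dac scb))

    ≔-injective : ∀ (a : Vec A n) i {c d} → a [ i ]≔ c ≡ a [ i ]≔ d → c ≡ d
    ≔-injective a i {c} {d} eq = trans (sym (lookup∘update i a c))
      (trans (cong (λ x → lookup x i) eq) (lookup∘update i a d))

    moves-≔ : ∀ (a : Vec A n) i b → Moves a (a [ i ]≔ b)
    -- Writing `a` as `a [ i ]≔ lookup a i` puts both states in the form required by `swap-map` and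
    -- `assign-map`. States off their line differ from both, hence are fixed.
    moves-≔ a i b = subst (λ u → Moves u (a [ i ]≔ b)) ([]≔-lookup a i)
      ( oneCell-on-line a i _ (A.swap (lookup a i) b)
          (M.swap-map (≔-injective a i) _ b) (λ x x≢ → V.swap-other (x≢ _) (x≢ _))
      , oneCell-on-line a i _ (A.assign (lookup a i) b)
          (M.assign-map (≔-injective a i) _ b) (λ x x≢ → V.assign-other (x≢ _)))

    moves : ∀ (a b : Vec A n) → Moves a b
    moves = ≔-connected Moves moves-refl moves-trans moves-≔

  vectors : List A → ∀ n → List (Vec A n)
  vectors as zero    = [] ∷ []
  vectors as (suc n) = cartesianProductWith _∷_ as (vectors as n)

  ∈-vectors : ∀ {as} → (∀ a → a ∈ as) → ∀ (x : Vec A n) → x ∈ vectors as n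
  ∈-vectors complete []      = here refl
  ∈-vectors complete (a ∷ x) =
    ∈-cartesianProductWith⁺ _∷_ (complete a) (∈-vectors complete x)

  oneCell-all : ∀ as → (∀ a → a ∈ as) → (f : Transformation A n) → OneCell f
  oneCell-all as complete f =
    let _ , oc , h≗f = generate f (vectors as _) (∈-vectors complete) in
    oneCell-resp-≗ h≗f oc
    where open Generation _≟ⱽ_ OneCell oneCell-id oneCell-∘
                 (λ a b → proj₁ (moves a b)) (λ a b → proj₂ (moves a b))

binaryWithOneCell : (A : Set) (q : ℕ) → A ↔ Fin q → 2 ≤ q →
  (n : ℕ) (f : Transformation A n) → BinaryComputableWithOneCell f
binaryWithOneCell A (suc (suc q)) A↔Fin _ n f =
  oneCell⇒binaryWithOneCell (oneCell-all (via-injection (↔⇒↣ A↔Fin) _≟ᶠ_)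
    {on = from zero} {off = from (suc zero)} on≢off (mapᴸ from (allFin _))
    (λ a → subst (_∈ _) (strictlyInverseʳ a) (∈-map⁺ from (∈-allFin (to a)))) f)
  where
  open Inverse A↔Fin
  on≢off : from zero ≢ from (suc zero)
  on≢off eq with trans (sym (strictlyInverseˡ zero)) (trans (cong to eq) (strictlyInverseˡ (suc zero)))
  ... | ()
binaryWithOneCell A (suc zero) _ (s≤s ())

-- Vector arithmetic over GF(2)

open CommutativeRing xor-∧-commutativeRing using (+-commutativeMonoid; semiring)
open CommutativeMonoidSum +-commutativeMonoid using (sum; sum-cong-≗; ∑-distrib-+; ∑-comm)
open SemiringSum semiring using (*-distribˡ-sum; *-distribʳ-sum)
open xor-∧-Solver using (solve; _:=_; _:+_; _:*_; con)

private variable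
  n : ℕ
  f g : Transformation GF2 n

𝟎 : Vec GF2 n
𝟎 = replicate _ false

unit : Fin n → Vec GF2 n
unit i = tabulate (identity i)

lookup-⊕ : ∀ (x y : Vec GF2 n) i → lookup (x ⊕ y) i ≡ lookup x i xor lookup y i
lookup-⊕ x y = lookup∘tabulate _

lookup-⊕³ : ∀ (x y z : Vec GF2 n) i →
            lookup (x ⊕ y ⊕ z) i ≡ (lookup x i xor lookup y i) xor lookup z i
lookup-⊕³ x y z i = trans (lookup-⊕ (x ⊕ y) z i) (cong (_xor lookup z i) (lookup-⊕ x y i))

lookup-𝟎 : ∀ i → lookup (𝟎 {n}) i ≡ false
lookup-𝟎 i = lookup-replicate i false

xor-cancelʳ : ∀ a b → (a xor b) xor b ≡ a
xor-cancelʳ = solve 2 (λ a b → (a :+ b) :+ b := a) refl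

⊕-cancelʳ : ∀ (x y : Vec GF2 n) → x ⊕ y ⊕ y ≡ x
⊕-cancelʳ x y = vec-ext λ i → trans (lookup-⊕³ x y y i) (xor-cancelʳ (lookup x i) (lookup y i))

⊕-identityˡ : ∀ (x : Vec GF2 n) → 𝟎 ⊕ x ≡ x
⊕-identityˡ x = vec-ext λ i → trans (lookup-⊕ 𝟎 x i) (cong (_xor lookup x i) (lookup-𝟎 i))

⊕-identityʳ : ∀ (x : Vec GF2 n) → x ⊕ 𝟎 ≡ x
⊕-identityʳ x = vec-ext λ i → trans (lookup-⊕ x 𝟎 i)
  (trans (cong (lookup x i xor_) (lookup-𝟎 i)) (xor-identityʳ _))

-- Affine maps and their matrices

AffineForm : (Vec GF2 n → GF2) → Set
AffineForm u = ∀ x y z → u (x ⊕ y ⊕ z) ≡ (u x xor u y) xor u z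

-- Over GF(2), affine combinations are generated by the sums of three points.
record Affine (f : Transformation GF2 n) : Set where
  constructor mkAffine
  field preserves : ∀ x y z → f (x ⊕ y ⊕ z) ≡ f x ⊕ f y ⊕ f z
open Affine

affine⇒coord : Affine f → ∀ i → AffineForm (coord f i)
affine⇒coord {f = f} af i x y z =
  trans (cong (λ v → lookup v i) (preserves af x y z)) (lookup-⊕³ (f x) (f y) (f z) i)

coord⇒affine : (∀ i → AffineForm (coord f i)) → Affine f
coord⇒affine {f = f} forms = mkAffine λ x y z → vec-ext λ i →
  trans (forms i x y z) (sym (lookup-⊕³ (f x) (f y) (f z) i))

lookup-affine : ∀ (i : Fin n) → AffineForm (λ x → lookup x i)
lookup-affine i x y z = lookup-⊕³ x y z i

affine-∘ : Affine g → Affine f → Affine (g ∘ f)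
affine-∘ {g = g} ag af = mkAffine λ x y z →
  trans (cong g (preserves af x y z)) (preserves ag _ _ _)

affine-inverse : ∀ g → Affine f → f ∘ g ≗ id → g ∘ f ≗ id → Affine g
affine-inverse g af fg gf = mkAffine λ x y z → trans
  (cong g (trans (sym (cong₂ _⊕_ (cong₂ _⊕_ (fg x) (fg y)) (fg z))) (sym (preserves af (g x) (g y) (g z)))))
  (gf _)

lookup-· : ∀ (x : Vec GF2 n) M j → lookup (x · M) j ≡ sum λ i → lookup x i ∧ M i j
lookup-· x M = lookup∘tabulate λ j → sum λ i → lookup x i ∧ M i j

unit-suc : ∀ (i : Fin n) → unit (suc i) ≡ false ∷ unit i
unit-suc i = cong (false ∷_) (vec-ext λ j → trans (lookup∘tabulate _ j)
  (trans (cong (if_then true else false) (trans (isYes≗does (suc i ≟ᶠ suc j)) (sym (isYes≗does (i ≟ᶠ j)))))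
  (sym (lookup∘tabulate _ j))))

unit-zero : unit {suc n} zero ≡ true ∷ 𝟎
unit-zero = cong (true ∷_) (vec-ext λ j → trans (lookup∘tabulate _ j) (sym (lookup-𝟎 j)))

-- Induction on the length: `u ∘ (false ∷_)` is an affine form in the remaining coordinates, and the
-- first bit contributes its own coefficient.
affineForm-expand : ∀ (u : Vec GF2 n → GF2) → AffineForm u → ∀ x →
  u x ≡ (sum λ i → lookup x i ∧ (u (unit i) xor u 𝟎)) xor u 𝟎
affineForm-expand u au [] = refl
affineForm-expand u au (b ∷ x) = trans (head b)
  (cong (_xor u 𝟎) (cong₂ _xor_ (cong (λ e → b ∧ (u e xor u 𝟎)) (sym unit-zero))
    (sum-cong-≗ λ i → cong (λ e → lookup x i ∧ (u e xor u 𝟎)) (sym (unit-suc i)))))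
  where
  tail : u (false ∷ x) ≡ (sum λ i → lookup x i ∧ (u (false ∷ unit i) xor u 𝟎)) xor u 𝟎
  tail = affineForm-expand (u ∘ (false ∷_)) (λ x y z → au (false ∷ x) (false ∷ y) (false ∷ z)) x

  head : ∀ b → u (b ∷ x) ≡ ((b ∧ (u (true ∷ 𝟎) xor u 𝟎)) xor
                            (sum λ i → lookup x i ∧ (u (false ∷ unit i) xor u 𝟎))) xor u 𝟎
  head false = tail
  -- `true ∷ x` is the sum of the three points `true ∷ 𝟎`, `𝟎` and `false ∷ x`, to which affinity
  -- applies.
  head true  = trans
    (cong (λ v → u (true ∷ v)) (sym (trans (cong (_⊕ x) (⊕-identityʳ 𝟎)) (⊕-identityˡ x))))
    (trans (au (true ∷ 𝟎) 𝟎 (false ∷ x))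
      (trans (cong ((u (true ∷ 𝟎) xor u 𝟎) xor_) tail)
        (solve 3 (λ p s q → (p :+ q) :+ (s :+ q) := ((p :+ q) :+ s) :+ q) refl (u (true ∷ 𝟎)) _ (u 𝟎))))

-- The matrix of the linear part of an affine `f`: adding the value at `𝟎` removes the constant.
matrix : Transformation GF2 n → Matrix n
matrix f i j = coord f j (unit i) xor coord f j 𝟎

affine-expand : Affine f → ∀ x → f x ≡ x · matrix f ⊕ f 𝟎
affine-expand {f = f} af x = vec-ext λ j →
  trans (affineForm-expand (coord f j) (affine⇒coord af j) x)
    (sym (trans (lookup-⊕ (x · matrix f) (f 𝟎) j)
      (cong (_xor coord f j 𝟎) (lookup-· x (matrix f) j))))

-- Row `i` of `matrix f` is the vector `r`, so the product entry is the linear part of the form `v`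
-- at `r`. Affinity of `v` turns this into the sum of the values of `v ∘ f` at `unit i` and `𝟎`,
-- where `g ∘ f` is the identity.
matrix-inverse : Affine f → Affine g → g ∘ f ≗ id →
                 ∀ i j → (matrix f ⊗ matrix g) i j ≡ identity i j
matrix-inverse {f = f} {g = g} af ag gf i j = begin
  (sum λ k → matrix f i k ∧ matrix g k j)
    ≡⟨ sum-cong-≗ (λ k → cong (_∧ matrix g k j) (sym (lookup-⊕ (f (unit i)) (f 𝟎) k))) ⟩
  (sum λ k → lookup r k ∧ matrix g k j)
    ≡⟨ xor-cancelʳ _ (v 𝟎) ⟨
  ((sum λ k → lookup r k ∧ matrix g k j) xor v 𝟎) xor v 𝟎
    ≡⟨ cong (_xor v 𝟎) (affineForm-expand v av r) ⟨
  v r xor v 𝟎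
    ≡⟨ cong (λ y → v y xor v 𝟎) (⊕-identityʳ r) ⟨
  v (r ⊕ 𝟎) xor v 𝟎
    ≡⟨ cong (_xor v 𝟎) (av (f (unit i)) (f 𝟎) 𝟎) ⟩
  ((v (f (unit i)) xor v (f 𝟎)) xor v 𝟎) xor v 𝟎
    ≡⟨ xor-cancelʳ _ (v 𝟎) ⟩
  v (f (unit i)) xor v (f 𝟎)
    ≡⟨ cong₂ (λ x y → lookup x j xor lookup y j) (gf (unit i)) (gf 𝟎) ⟩
  lookup (unit i) j xor lookup 𝟎 j
    ≡⟨ cong₂ _xor_ (lookup∘tabulate (identity i) j) (lookup-𝟎 j) ⟩
  identity i j xor false
    ≡⟨ xor-identityʳ _ ⟩
  identity i j ∎
  where
  open ≡-Reasoning
  v = coord g j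
  av = affine⇒coord {f = g} ag j
  r = f (unit i) ⊕ f 𝟎

affine-bijection⇒Aff : ∀ g → Affine f → f ∘ g ≗ id → g ∘ f ≗ id → Aff n f
affine-bijection⇒Aff {f = f} g af fg gf =
  let ag = affine-inverse g af fg gf in
  matrix f , f 𝟎 ,
  (matrix g , matrix-inverse af ag gf , matrix-inverse ag af fg) , affine-expand af

·-affine : ∀ (M : Matrix n) (c : Vec GF2 n) → Affine (λ x → x · M ⊕ c)
·-affine M c = coord⇒affine λ j x y z → begin
  lookup ((x ⊕ y ⊕ z) · M ⊕ c) j
    ≡⟨ expand (x ⊕ y ⊕ z) j ⟩
  (sum λ i → lookup (x ⊕ y ⊕ z) i ∧ M i j) xor lookup c j
    ≡⟨ cong (_xor lookup c j) (sum-cong-≗ λ i → trans (cong (_∧ M i j) (lookup-⊕³ x y z i))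
         (distrib (lookup x i) (lookup y i) (lookup z i) (M i j))) ⟩
  (sum λ i → ((lookup x i ∧ M i j) xor (lookup y i ∧ M i j)) xor (lookup z i ∧ M i j)) xor lookup c j
    ≡⟨ cong (_xor lookup c j) (trans (∑-distrib-+ (λ i → (lookup x i ∧ M i j) xor (lookup y i ∧ M i j)) _)
         (cong (_xor row z j) (∑-distrib-+ (λ i → lookup x i ∧ M i j) _))) ⟩
  ((row x j xor row y j) xor row z j) xor lookup c j
    -- Three copies of the constant equal one copy over GF(2).
    ≡⟨ solve 4 (λ p q r s → ((p :+ q) :+ r) :+ s := ((p :+ s) :+ (q :+ s)) :+ (r :+ s)) refl
         (row x j) (row y j) (row z j) (lookup c j) ⟩
  ((row x j xor lookup c j) xor (row y j xor lookup c j)) xor (row z j xor lookup c j)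
    ≡⟨ cong₂ _xor_ (cong₂ _xor_ (expand x j) (expand y j)) (expand z j) ⟨
  (lookup (x · M ⊕ c) j xor lookup (y · M ⊕ c) j) xor lookup (z · M ⊕ c) j ∎
  where
  open ≡-Reasoning
  row : Vec GF2 _ → Fin _ → GF2
  row x j = sum λ i → lookup x i ∧ M i j
  expand : ∀ x j → lookup (x · M ⊕ c) j ≡ row x j xor lookup c j
  expand x j = trans (lookup-⊕ (x · M) c j) (cong (_xor lookup c j) (lookup-· x M j))
  distrib : ∀ a b c d → ((a xor b) xor c) ∧ d ≡ ((a ∧ d) xor (b ∧ d)) xor (c ∧ d)
  distrib = solve 4 (λ a b c d → ((a :+ b) :+ c) :* d := ((a :* d) :+ (b :* d)) :+ (c :* d)) refl

·-inverse : ∀ {M M′ : Matrix n} → (∀ i j → (M ⊗ M′) i j ≡ identity i j) →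
            ∀ x → x · M · M′ ≡ x
·-inverse {M = M} {M′} inv x = vec-ext λ j → begin
  lookup (x · M · M′) j
    ≡⟨ lookup-· (x · M) M′ j ⟩
  (sum λ k → lookup (x · M) k ∧ M′ k j)
    ≡⟨ sum-cong-≗ (λ k → trans (cong (_∧ M′ k j) (lookup-· x M k))
         (*-distribʳ-sum (M′ k j) (λ i → lookup x i ∧ M i k))) ⟩
  (sum λ k → sum λ i → (lookup x i ∧ M i k) ∧ M′ k j)
    ≡⟨ ∑-comm (λ k i → (lookup x i ∧ M i k) ∧ M′ k j) ⟩
  (sum λ i → sum λ k → (lookup x i ∧ M i k) ∧ M′ k j)
    ≡⟨ sum-cong-≗ (λ i → trans (sum-cong-≗ λ k → ∧-assoc (lookup x i) (M i k) (M′ k j))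
         (sym (*-distribˡ-sum (lookup x i) λ k → M i k ∧ M′ k j))) ⟩
  (sum λ i → lookup x i ∧ (M ⊗ M′) i j)
    -- The identity entries are written as the coefficients of the form `λ y → lookup y j`, so that
    -- `affineForm-expand` evaluates the sum.
    ≡⟨ sum-cong-≗ (λ i → cong (lookup x i ∧_) (trans (inv i j) (sym (trans
         (cong₂ _xor_ (lookup∘tabulate (identity i) j) (lookup-𝟎 j)) (xor-identityʳ _))))) ⟩
  (sum λ i → lookup x i ∧ (lookup (unit i) j xor lookup 𝟎 j))
    ≡⟨ xor-identityʳ _ ⟨
  (sum λ i → lookup x i ∧ (lookup (unit i) j xor lookup 𝟎 j)) xor false
    ≡⟨ cong ((sum λ i → lookup x i ∧ (lookup (unit i) j xor lookup 𝟎 j)) xor_) (lookup-𝟎 j) ⟨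
  (sum λ i → lookup x i ∧ (lookup (unit i) j xor lookup 𝟎 j)) xor lookup 𝟎 j
    ≡⟨ affineForm-expand (λ y → lookup y j) (lookup-affine j) x ⟨
  lookup x j ∎
  where
  open ≡-Reasoning

-- Translations and shears by binary programs

≔-ext : ∀ {x y : Vec GF2 n} i {a} → a ≡ lookup y i →
        (∀ j → j ≢ i → lookup x j ≡ lookup y j) → x [ i ]≔ a ≡ y
≔-ext {x = x} {y} i {a} at-i elsewhere = vec-ext agree
  where
  agree : ∀ j → lookup (x [ i ]≔ a) j ≡ lookup y j
  agree j with j ≟ᶠ i
  ... | yes refl = trans (lookup∘update i x a) at-i
  ... | no j≢i   = trans (lookup∘update′ j≢i x a) (elsewhere j j≢i)

-- Starting from `𝟎`, the translation vector is changed one entry at a time; each change costs one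
-- write adding the difference of the old and new entries.
binary-translation : ∀ (c : Vec GF2 n) → BinaryComputable (_⊕ c)
binary-translation c = ≔-connected (λ a b → BinaryComputable (_⊕ a) → BinaryComputable (_⊕ b))
  id (λ p q → q ∘ p) edge 𝟎 c (binary-resp-≗ (sym ∘ ⊕-identityʳ) binary-id)
  where
  edge : ∀ a i b → BinaryComputable (_⊕ a) → BinaryComputable (_⊕ (a [ i ]≔ b))
  edge a i b ba = binary-resp-≗
    (λ y → ≔-ext i
      (trans (cong (_xor (lookup a i xor b)) (lookup-⊕ y a i))
        (trans (solve 3 (λ p q r → (p :+ q) :+ (q :+ r) := p :+ r) refl (lookup y i) (lookup a i) b)
          (sym (trans (lookup-⊕ y (a [ i ]≔ b) i) (cong (lookup y i xor_) (lookup∘update i a b))))))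
      (λ j j≢i → trans (lookup-⊕ y a j)
        (sym (trans (lookup-⊕ y (a [ i ]≔ b) j) (cong (lookup y j xor_) (lookup∘update′ j≢i a b))))))
    (binary-∘ (binary-write i i i (λ t _ → t xor (lookup a i xor b))) ba)

shear : Fin n → Vec GF2 n → Transformation GF2 n
shear s c y = if lookup y s then y ⊕ c else y

lookup-shear : ∀ s c (y : Vec GF2 n) j →
               lookup (shear s c y) j ≡ lookup y j xor (lookup y s ∧ lookup c j)
lookup-shear s c y j with lookup y s
... | true  = lookup-⊕ y c j
... | false = sym (xor-identityʳ _)

shear-fixes : ∀ s c (y : Vec GF2 n) → lookup y s ≡ false → shear s c y ≡ y
shear-fixes s c y eq rewrite eq = refl

shear-affine : ∀ s (c : Vec GF2 n) → Affine (shear s c)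
shear-affine s c = coord⇒affine λ j x y z → trans (lookup-shear s c (x ⊕ y ⊕ z) j)
  (trans (cong₂ (λ p q → p xor (q ∧ lookup c j)) (lookup-⊕³ x y z j) (lookup-⊕³ x y z s))
    (trans (identity₇ (lookup x j) (lookup y j) (lookup z j) (lookup x s) (lookup y s) (lookup z s) (lookup c j))
      (sym (cong₂ _xor_ (cong₂ _xor_ (lookup-shear s c x j) (lookup-shear s c y j)) (lookup-shear s c z j)))))
  where
  identity₇ : ∀ a b d p q r c → ((a xor b) xor d) xor (((p xor q) xor r) ∧ c) ≡
              ((a xor (p ∧ c)) xor (b xor (q ∧ c))) xor (d xor (r ∧ c))
  identity₇ = solve 7 (λ a b d p q r c → ((a :+ b) :+ d) :+ (((p :+ q) :+ r) :* c) :=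
              ((a :+ (p :* c)) :+ (b :+ (q :* c))) :+ (d :+ (r :* c))) refl

-- As `c` vanishes at `s`, the shear preserves the bit at `s`, so a second application adds `c`
-- again exactly when the first did.
shear-involutive : ∀ s (c : Vec GF2 n) → lookup c s ≡ false → shear s c ∘ shear s c ≗ id
shear-involutive s c cs y = vec-ext λ j → trans (lookup-shear s c (shear s c y) j)
  (trans (cong₂ (λ p q → p xor (q ∧ lookup c j)) (lookup-shear s c y j)
      (trans (lookup-shear s c y s) (cong (λ b → lookup y s xor (lookup y s ∧ b)) cs)))
    (solve 3 (λ p q c → (p :+ (q :* c)) :+ ((q :+ (q :* con false)) :* c) := p) refl
      (lookup y j) (lookup y s) (lookup c j)))

-- Built up entry by entry as for translations, with the entry at `s` held at `false` throughout.
-- Each partial shear therefore preserves the bit at `s`, and the next write, which reads cells `i`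
-- and `s`, still finds its original value.
binary-shear : ∀ s (c : Vec GF2 n) → lookup c s ≡ false → BinaryComputable (shear s c)
binary-shear s c cs = subst (BinaryComputable ∘ shear s) (trans (cong (c [ s ]≔_) (sym cs)) ([]≔-lookup c s))
  (≔-connected (λ a b → Computable a → Computable b) id (λ p q → q ∘ p) edge 𝟎 c
    (binary-resp-≗ start binary-id))
  where
  Computable : Vec GF2 _ → Set
  Computable a = BinaryComputable (shear s (a [ s ]≔ false))

  start : ∀ y → y ≡ shear s (𝟎 [ s ]≔ false) y
  start y with lookup y s
  ... | false = refl
  ... | true  = sym (trans (cong (y ⊕_) 𝟎-≔) (⊕-identityʳ y))
    where
    𝟎-≔ : 𝟎 [ s ]≔ false ≡ 𝟎
    𝟎-≔ = trans (cong (𝟎 [ s ]≔_) (sym (lookup-𝟎 s))) ([]≔-lookup 𝟎 s)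

  edge : ∀ a i b → Computable a → Computable (a [ i ]≔ b)
  edge a i b ba with i ≟ᶠ s
  ... | yes refl = subst (BinaryComputable ∘ shear s) (sym ([]≔-idempotent a s)) ba
  ... | no i≢s   = subst (BinaryComputable ∘ shear s) ([]≔-commutes a s i (i≢s ∘ sym))
    (binary-resp-≗
      (λ y → ≔-ext i
        (trans (cong₂ (λ p q → p xor (q ∧ (lookup a′ i xor b))) (lookup-shear s a′ y i)
                 (trans (lookup-shear s a′ y s)
                   (cong (λ d → lookup y s xor (lookup y s ∧ d)) (lookup∘update s a false))))
          (trans (solve 4 (λ p q c b → (p :+ (q :* c)) :+ ((q :+ (q :* con false)) :* (c :+ b)) := p :+ (q :* b))
                   refl (lookup y i) (lookup y s) (lookup a′ i) b)
            (sym (trans (lookup-shear s (a′ [ i ]≔ b) y i)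
              (cong (λ d → lookup y i xor (lookup y s ∧ d)) (lookup∘update i a′ b))))))
        (λ j j≢i → trans (lookup-shear s a′ y j) (sym (trans (lookup-shear s (a′ [ i ]≔ b) y j)
          (cong (λ d → lookup y j xor (lookup y s ∧ d)) (lookup∘update′ j≢i a′ b))))))
      (binary-∘ (binary-write i i s (λ t m → t xor (m ∧ (lookup a′ i xor b)))) ba))
    where a′ = a [ s ]≔ false

-- Gaussian elimination

-- Membership in the span of the first `k` unit vectors, the subspace fixed pointwise after `k`
-- rounds of elimination.
VanishesFrom : ℕ → Vec GF2 n → Set
VanishesFrom k x = ∀ i → k ≤ toℕ i → lookup x i ≡ false

Inj : Transformation GF2 n → Set
Inj f = Injective _≡_ _≡_ f

involutive⇒inj : ∀ (f : Transformation GF2 n) → f ∘ f ≗ id → Inj f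
involutive⇒inj f inv {x} {y} eq = trans (sym (inv x)) (trans (cong f eq) (inv y))

lookup-unit-same : ∀ (i : Fin n) → lookup (unit i) i ≡ true
lookup-unit-same i = trans (lookup∘tabulate _ i) lem
  where
  lem : identity i i ≡ true
  lem with i ≟ᶠ i
  ... | yes _  = refl
  ... | no i≢i = contradiction refl i≢i

lookup-unit-other : ∀ {i j : Fin n} → i ≢ j → lookup (unit i) j ≡ false
lookup-unit-other {i = i} {j} i≢j = trans (lookup∘tabulate _ j) lem
  where
  lem : identity i j ≡ false
  lem with i ≟ᶠ j
  ... | yes i≡j = contradiction i≡j i≢j
  ... | no _    = refl

-- If `f (unit i)` vanished from `k` on, `f` would fix it; by injectivity it would equal `unit i`,
-- whose entry at `i` is `true`.
pivot : ∀ (f : Transformation GF2 n) {k} → Inj f → (∀ x → VanishesFrom k x → f x ≡ x) → ∀ i → k ≤ toℕ i →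
        ∃ λ l → k ≤ toℕ l × coord f l (unit i) ≡ true
pivot f {k} inj fixes i k≤i = l , k≤l , ¬-not (λ eq → ¬P λ _ → eq)
  where
  v = f (unit i)
  not-vanishing : ¬ VanishesFrom k v
  not-vanishing van with trans (sym (lookup-unit-same i))
    (trans (cong (λ x → lookup x i) (sym (inj (fixes v van)))) (van i k≤i))
  ... | ()
  search = ¬∀⟶∃¬ _ _ (λ l → (k ≤? toℕ l) →-dec (lookup v l ≟ᵇ false)) not-vanishing
  l = proj₁ search
  ¬P = proj₂ search
  k≤l = decidable-stable (k ≤? toℕ l) (λ k≰l → ¬P λ k≤l → contradiction k≤l k≰l)

-- One shear from the pivot `l` makes entry `i` of the column `true`, and one from `i` clears the
-- other entries. Both sources have index at least `k`, so vectors vanishing from `k` on stay fixed.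
clear-column : ∀ {k} → Affine f → Inj f → (∀ x → VanishesFrom k x → f x ≡ x) →
  ∀ i → toℕ i ≡ k → ∃ λ h → BinaryComputable h × Affine h × Inj h ×
    (∀ x → VanishesFrom k x → h x ≡ x) × h (f (unit i)) ≡ unit i
clear-column {f = f} {k} af inj fixes i i≡k =
  shear i d ∘ shear l c ,
  binary-∘ (binary-shear i d d-i) (binary-shear l c c-l) ,
  affine-∘ (shear-affine i d) (shear-affine l c) ,
  (involutive⇒inj (shear l c) (shear-involutive l c c-l) ∘
    involutive⇒inj (shear i d) (shear-involutive i d d-i)) ,
  (λ x van → trans (cong (shear i d) (shear-fixes l c x (van l k≤l)))
                   (shear-fixes i d x (van i k≤i))) ,
  clears
  where
  k≤i = ≤-reflexive (sym i≡k)
  v = f (unit i)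
  search = pivot f inj fixes i k≤i
  l = proj₁ search
  k≤l = proj₁ (proj₂ search)
  v-l = proj₂ (proj₂ search)

  c : Vec GF2 _
  -- Adds a one at `i` only if the column lacks it. When `l` is `i` the entry is already `true`, so
  -- `c` is zero and still vanishes at `l`.
  c = 𝟎 [ i ]≔ not (lookup v i)

  c-l : lookup c l ≡ false
  c-l with l ≟ᶠ i
  ... | yes l≡i = trans (cong (lookup c) l≡i) (trans (lookup∘update i 𝟎 _)
                    (cong not (trans (cong (lookup v) (sym l≡i)) v-l)))
  ... | no l≢i  = trans (lookup∘update′ l≢i 𝟎 _) (lookup-𝟎 l)

  w : Vec GF2 _
  w = shear l c v

  w-i : lookup w i ≡ true
  w-i = trans (lookup-shear l c v i) (trans (cong₂ (λ p q → lookup v i xor (p ∧ q)) v-l (lookup∘update i 𝟎 _))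
    (solve 1 (λ p → p :+ (con true :* (con true :+ p)) := con true) refl (lookup v i)))

  d : Vec GF2 _
  d = w ⊕ unit i

  d-i : lookup d i ≡ false
  d-i = trans (lookup-⊕ w (unit i) i) (cong₂ _xor_ w-i (lookup-unit-same i))

  clears : shear i d w ≡ unit i
  clears = vec-ext λ j → trans (lookup-shear i d w j)
    (trans (cong₂ (λ p q → lookup w j xor (p ∧ q)) w-i (lookup-⊕ w (unit i) j))
      (solve 2 (λ p q → p :+ (con true :* (p :+ q)) := q) refl (lookup w j) (lookup (unit i) j)))

-- Fixed points of an affine map are closed under sums of three. A vector with a one at `i` is the
-- sum of `unit i`, `𝟎` and a vector vanishing from `k` on.
extend-fixed : ∀ {k} → Affine f → (∀ x → VanishesFrom k x → f x ≡ x) →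
  ∀ i → toℕ i ≡ k → f (unit i) ≡ unit i → ∀ x → VanishesFrom (suc k) x → f x ≡ x
extend-fixed {f = f} {k} af fixes i i≡k fixes-unit x van with lookup x i in x-i
... | false = fixes x van′
  where
  van′ : VanishesFrom k x
  van′ j k≤j with i ≟ᶠ j
  ... | yes refl = x-i
  ... | no i≢j   = van j (≤∧≢⇒< k≤j λ k≡j → i≢j (toℕ-injective (trans i≡k k≡j)))
... | true  = begin
  f x                       ≡⟨ cong f x≡ ⟨
  f (x′ ⊕ unit i ⊕ 𝟎)       ≡⟨ preserves af x′ (unit i) 𝟎 ⟩
  f x′ ⊕ f (unit i) ⊕ f 𝟎   ≡⟨ cong₂ _⊕_ (cong₂ _⊕_ (fixes x′ van′) fixes-unit) (fixes 𝟎 λ j _ → lookup-𝟎 j) ⟩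
  x′ ⊕ unit i ⊕ 𝟎           ≡⟨ x≡ ⟩
  x                         ∎
  where
  open ≡-Reasoning
  x′ = x ⊕ unit i
  x≡ : x′ ⊕ unit i ⊕ 𝟎 ≡ x
  x≡ = trans (⊕-identityʳ _) (⊕-cancelʳ x (unit i))
  van′ : VanishesFrom k x′
  van′ j k≤j with i ≟ᶠ j
  ... | yes refl = trans (lookup-⊕ x (unit i) i) (cong₂ _xor_ x-i (lookup-unit-same i))
  ... | no i≢j   = trans (lookup-⊕ x (unit i) j) (cong₂ _xor_
    (van j (≤∧≢⇒< k≤j λ k≡j → i≢j (toℕ-injective (trans i≡k k≡j)))) (lookup-unit-other i≢j))

eliminate : Affine f → Inj f → ∀ k → k ≤ n → ∃ λ (h : Transformation GF2 n) →
  BinaryComputable h × Affine (h ∘ f) × Inj (h ∘ f) ×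
  (∀ x → VanishesFrom k x → h (f x) ≡ x)
eliminate {f = f} af inj zero _ =
  -- Only `𝟎` vanishes from index zero on, and translating by `f 𝟎` makes it a fixed point.
  (_⊕ f 𝟎) , binary-translation (f 𝟎) ,
  coord⇒affine (λ j x y z → trans (lookup-⊕ (f (x ⊕ y ⊕ z)) (f 𝟎) j)
    (trans (cong (_xor coord f j 𝟎) (affine⇒coord af j x y z))
      (trans (solve 4 (λ p q r s → ((p :+ q) :+ r) :+ s := ((p :+ s) :+ (q :+ s)) :+ (r :+ s)) refl
        (coord f j x) (coord f j y) (coord f j z) (coord f j 𝟎))
      (sym (cong₂ _xor_ (cong₂ _xor_ (lookup-⊕ (f x) (f 𝟎) j) (lookup-⊕ (f y) (f 𝟎) j))
        (lookup-⊕ (f z) (f 𝟎) j)))))) ,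
  (λ {x} {y} eq → inj (trans (sym (⊕-cancelʳ (f x) (f 𝟎)))
    (trans (cong (_⊕ f 𝟎) eq) (⊕-cancelʳ (f y) (f 𝟎))))) ,
  λ x van → let x≡𝟎 = vec-ext (λ i → trans (van i z≤n) (sym (lookup-𝟎 i))) in
    trans (cong (λ y → f y ⊕ f 𝟎) x≡𝟎)
      (trans (cong (_⊕ f 𝟎) (sym (⊕-identityˡ (f 𝟎)))) (trans (⊕-cancelʳ 𝟎 (f 𝟎)) (sym x≡𝟎)))
eliminate af inj (suc k) k<n =
  let h , bh , ah , ih , fixes = eliminate af inj k (<⇒≤ k<n)
      i = fromℕ< k<n
      i≡k = toℕ-fromℕ< k<n
      h′ , bh′ , ah′ , ih′ , fixes′ , clears = clear-column ah ih fixes i i≡k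
      a = affine-∘ ah′ ah
  in h′ ∘ h , binary-∘ bh′ bh , a , ih ∘ ih′ ,
     extend-fixed a (λ x van → trans (cong h′ (fixes x van)) (fixes′ x van)) i i≡k clears

affine-inj⇒binary-inverse : Affine f → Inj f →
  ∃ λ (h : Transformation GF2 n) → BinaryComputable h × h ∘ f ≗ id
affine-inj⇒binary-inverse {n = n} af inj =
  let h , bh , _ , _ , fixes = eliminate af inj n ≤-refl in
  -- No index reaches `n`, so after `n` rounds every vector is fixed.
  h , bh , λ x → fixes x λ i n≤i → contradiction n≤i (<⇒≱ (toℕ<n i))

-- Affine permutations are computed by binary programs

inverse⇒permutation : ∀ g → f ∘ g ≗ id → g ∘ f ≗ id → Permutation f
inverse⇒permutation {f = f} g fg gf =
  (λ {x} {y} eq → trans (sym (gf x)) (trans (cong g eq) (gf y))) ,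
  λ y → g y , λ { refl → fg y }

Aff⇒binary-permutation : Aff n f → Permutation f × BinaryComputable f
Aff⇒binary-permutation {n = n} {f = f} (M , c , (M′ , MM′ , M′M) , f≗) =
  inverse⇒permutation f⁻¹ fg gf ,
  (let h , bh , hg = affine-inj⇒binary-inverse (affine-inverse f⁻¹ af fg gf) (λ {x} {y} eq →
         trans (sym (fg x)) (trans (cong f eq) (fg y)))
   in binary-resp-≗ (λ x → trans (cong h (sym (gf x))) (hg (f x))) bh)
  where
  f⁻¹ : Transformation GF2 n
  f⁻¹ y = (y ⊕ c) · M′
  fg : f ∘ f⁻¹ ≗ id
  fg y = trans (f≗ (f⁻¹ y)) (trans (cong (_⊕ c) (·-inverse M′M (y ⊕ c))) (⊕-cancelʳ y c))
  gf : f⁻¹ ∘ f ≗ id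
  gf x = trans (cong (λ y → (y ⊕ c) · M′) (f≗ x))
    (trans (cong (_· M′) (⊕-cancelʳ (x · M) c)) (·-inverse MM′ x))
  af : Affine f
  af = mkAffine λ x y z → trans (f≗ _) (trans (preserves (·-affine M c) x y z)
    (sym (cong₂ _⊕_ (cong₂ _⊕_ (f≗ x) (f≗ y)) (f≗ z))))

-- Binary programs for permutations are affine

-- A function of one bit is a polynomial of degree at most one, by interpolation at the two bits.
unary-affine : ∀ (β : GF2 → GF2) a b c → β ((a xor b) xor c) ≡ (β a xor β b) xor β c
unary-affine β a b c = trans (expand _)
  (trans (solve 5 (λ p q a b c → p :+ (((a :+ b) :+ c) :* q) :=
            ((p :+ (a :* q)) :+ (p :+ (b :* q))) :+ (p :+ (c :* q))) refl
          (β false) (β false xor β true) a b c)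
    (sym (cong₂ _xor_ (cong₂ _xor_ (expand a) (expand b)) (expand c))))
  where
  expand : ∀ a → β a ≡ β false xor (a ∧ (β false xor β true))
  expand false = sym (xor-identityʳ _)
  expand true  = solve 2 (λ p q → q := p :+ (p :+ q)) refl (β false) (β true)

-- The hypothesis forces `φ a b` to be `a xor φ false b`, a sum of functions of one bit each.
odd⇒affine : ∀ (φ : GF2 → GF2 → GF2) → (∀ a b → φ (not a) b ≡ not (φ a b)) →
  ∀ a b c a′ b′ c′ → φ ((a xor b) xor c) ((a′ xor b′) xor c′) ≡ (φ a a′ xor φ b b′) xor φ c c′
odd⇒affine φ odd a b c a′ b′ c′ = trans (split _ _)
  (trans (cong (((a xor b) xor c) xor_) (unary-affine (φ false) a′ b′ c′))
    (trans (solve 6 (λ a b c p q r → ((a :+ b) :+ c) :+ ((p :+ q) :+ r) :=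
              ((a :+ p) :+ (b :+ q)) :+ (c :+ r)) refl a b c (φ false a′) (φ false b′) (φ false c′))
      (sym (cong₂ _xor_ (cong₂ _xor_ (split a a′) (split b b′)) (split c c′)))))
  where
  split : ∀ a b → φ a b ≡ a xor φ false b
  split false b = refl
  split true  b = odd false b

module InjectiveInstruction (ins : Instruction GF2 n)
  (inj : Inj (Instruction.map ins)) where

  open Instruction ins renaming (map to m; target to t)

  flip : Vec GF2 n → Vec GF2 n
  flip y = y [ t ]≔ not (lookup y t)

  -- The states `y` and `flip y` differ only at the target, so equal target values would give them
  -- the same image, against injectivity.
  coord-flip : ∀ y → coord m t (flip y) ≡ not (coord m t y)
  coord-flip y = ¬-not λ eq → not-¬ {lookup y t} refl (sym (trans (sym (lookup∘update t y _))
    (cong (λ v → lookup v t) (inj (vec-ext (agree eq))))))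
    where
    agree : coord m t (flip y) ≡ coord m t y → ∀ j → coord m j (flip y) ≡ coord m j y
    agree eq j with j ≟ᶠ t
    ... | yes refl = eq
    ... | no j≢t   = trans (trivial j j≢t (flip y))
      (trans (lookup∘update′ j≢t y _) (sym (trivial j j≢t y)))

  map-≔ : ∀ y → m y ≡ y [ t ]≔ coord m t y
  map-≔ y = sym (≔-ext t refl λ j j≢t → sym (trivial j j≢t y))

  -- The instruction either fixes `y` or flips its target bit, and then `coord-flip` makes it flip
  -- back. This supplies the inverse needed to peel it off a program.
  involutive : m ∘ m ≗ id
  involutive y with coord m t y ≟ᵇ lookup y t
  ... | yes eq = trans (cong m fixed) fixed
    where fixed = trans (map-≔ y) (trans (cong (y [ t ]≔_) eq) ([]≔-lookup y t))
  ... | no neq = trans (cong m flips) (trans (map-≔ (flip y))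
    (trans ([]≔-idempotent y t)
      (trans (cong (y [ t ]≔_) (trans (coord-flip y) (trans (cong not (¬-not neq)) (not-involutive _))))
        ([]≔-lookup y t))))
    where flips = trans (map-≔ y) (cong (y [ t ]≔_) (¬-not neq))

  affine-at-target : ∀ j k φ → t ≡ j → (∀ y → coord m t y ≡ φ (lookup y j) (lookup y k)) →
                     AffineForm (coord m t)
  affine-at-target _ k φ refl eq x y z with k ≟ᶠ t
  ... | yes refl = trans (eq _) (trans (cong (λ a → φ a a) (lookup-⊕³ x y z t))
    (trans (unary-affine (λ a → φ a a) _ _ _)
      (sym (cong₂ _xor_ (cong₂ _xor_ (eq x) (eq y)) (eq z)))))
  ... | no k≢t = trans (eq _) (trans (cong₂ φ (lookup-⊕³ x y z t) (lookup-⊕³ x y z k))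
    (trans (odd⇒affine φ odd (lookup x t) _ _ (lookup x k) _ _)
      (sym (cong₂ _xor_ (cong₂ _xor_ (eq x) (eq y)) (eq z)))))
    where
    odd : ∀ a b → φ (not a) b ≡ not (φ a b)
    odd a b = trans
      (sym (trans (eq (flip p)) (cong₂ φ (trans (lookup∘update t p _) (cong not p-t))
        (trans (lookup∘update′ k≢t p _) p-k))))
      (trans (coord-flip p) (cong not (trans (eq p) (cong₂ φ p-t p-k))))
      where
      -- A state showing arbitrary bits `a` at `t` and `b` at `k`, so that the behaviour of the
      -- instruction determines `φ` on all arguments.
      p = replicate n b [ t ]≔ a
      p-t = lookup∘update t (replicate n b) a
      p-k = trans (lookup∘update′ k≢t (replicate n b) a) (lookup-replicate k b)

  affine : Binary ins → Affine m
  affine (j , k , φ , eq) = coord⇒affine forms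
    where
    at-target : AffineForm (coord m t)
    at-target with t ≟ᶠ j | t ≟ᶠ k
    ... | yes t≡j | _ = affine-at-target j k φ t≡j eq
    ... | no _ | yes t≡k = affine-at-target k j (λ a b → φ b a) t≡k eq
    -- If neither variable is the target, flipping the target bit of `𝟎` leaves the value of `φ`
    -- unchanged, contrary to `coord-flip`.
    ... | no t≢j | no t≢k = contradiction
      (trans (eq 𝟎) (trans (sym (cong₂ φ (lookup∘update′ (t≢j ∘ sym) 𝟎 _) (lookup∘update′ (t≢k ∘ sym) 𝟎 _)))
        (sym (eq (flip 𝟎)))))
      (λ u≡ → not-¬ refl (trans u≡ (coord-flip 𝟎)))

    forms : ∀ i → AffineForm (coord m i)
    forms i x y z with i ≟ᶠ t
    ... | yes refl = at-target x y z
    ... | no i≢t   = trans (trivial i i≢t _) (trans (lookup-⊕³ x y z i)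
      (sym (cong₂ _xor_ (cong₂ _xor_ (trivial i i≢t x) (trivial i i≢t y)) (trivial i i≢t z))))

-- The first instruction inherits injectivity from the whole run. As it is its own inverse, the rest
-- is the whole run precomposed with it, hence injective too.
injective-run⇒affine : ∀ (p : Program GF2 n) → All Binary p → Inj (run p) → Affine (run p)
injective-run⇒affine [] [] inj = mkAffine λ x y z → refl
injective-run⇒affine (ins ∷ p) (b ∷ bs) inj =
  affine-∘ (injective-run⇒affine p bs inj-rest) (affine b)
  where
  m = Instruction.map ins
  inj-ins : Inj m
  inj-ins eq = inj (cong (run p) eq)
  open InjectiveInstruction ins inj-ins using (involutive; affine)
  inj-rest : Inj (run p)
  inj-rest {x} {y} eq = trans (sym (involutive x)) (trans
    (cong m (inj (trans (cong (run p) (involutive x)) (trans eq (sym (cong (run p) (involutive y)))))))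
    (involutive y))

binary-permutation⇒Aff : Permutation f → BinaryComputable f → Aff n f
binary-permutation⇒Aff {f = f} (inj , surj) (p , bs , p≗f) =
  -- The preimages chosen by surjectivity form a right inverse; injectivity makes it a left inverse
  -- as well.
  affine-bijection⇒Aff f⁻¹ af fg (λ x → inj (fg (f x)))
  where
  f⁻¹ = proj₁ ∘ surj
  fg : f ∘ f⁻¹ ≗ id
  fg y = proj₂ (surj y) refl
  af : Affine f
  af = mkAffine λ x y z → trans (sym (p≗f _)) (trans
    (preserves (injective-run⇒affine p bs λ {x} {y} eq → inj (trans (sym (p≗f x)) (trans eq (p≗f y)))) x y z)
    (cong₂ _⊕_ (cong₂ _⊕_ (p≗f x) (p≗f y)) (p≗f z)))

theorem6 : ((n : ℕ) → 2 ≤ n →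
    (Permutation {A = GF2} {n = n} ∩ BinaryComputable) ≐ Aff n)
    ×
    ((A : Set) (q : ℕ) → A ↔ Fin q → 2 ≤ q →
    (n : ℕ) → 2 ≤ n →
    (f : Transformation A n) → BinaryComputableWithOneCell f)
theorem6 =
  (λ n _ → (λ (perm , bc) → binary-permutation⇒Aff perm bc) , Aff⇒binary-permutation) ,
  (λ A q A↔Fin 2≤q n _ → binaryWithOneCell A q A↔Fin 2≤q n)
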